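{- For every integer $n>58$ there are at least $3248$ prime numbers $p$ with $n<p<520n$. -}

module Defs where

{-# OPTIONS --safe #-}

-- For n ≤ 292 the primes between 293 and 30680 = 520 * 59 are exactly enough.
-- For n ≥ 293 put N = 520 n - 1. By the recurrence of the Leibniz harmonic
-- triangle, (i + 1) * (i C k) divides every common multiple of 1, …, i + 1, so
-- summing over k gives lcm(1, …, N) ≥ 2 ^ (N - 1). In this lcm the primes below
-- r, where r * r > N, contribute at most N ^ r, the other primes up to n at most
-- their product, which is at most 8 ^ n, and the primes above n at most N each.
-- Fewer than 3248 primes above n would make the lcm too small.

module Submission where

open import Data.Bool using (Bool; true; false; if_then_else_; T; _∧_)
open import Data.Bool.Properties using (T?; T-∧)
open import Data.Fin using (zero; suc; fromℕ<)
open import Data.Fin.Properties using (fromℕ<-injective; injective⇒≤)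
open import Data.List using (List; []; _∷_; length; filter; map; upTo; downFrom; lookup)
open import Data.List.Membership.Propositional using (_∈_)
open import Data.List.Membership.Propositional.Properties using (∈-filter⁺; ∈-upTo⁺; ∈-map⁺; ∈-lookup)
open import Data.List.Properties using (length-map; map-id)
open import Data.List.Relation.Unary.All as All using (All; []; _∷_)
import Data.List.Relation.Unary.All.Properties as All
open import Data.List.Relation.Unary.Unique.Propositional using (Unique; []; _∷_)
import Data.List.Relation.Unary.Unique.Propositional.Properties as Unique
open import Data.Nat
open import Data.Nat.Combinatorics
open import Data.Nat.Coprimality using (Coprime; coprime-divisor)
open import Data.Nat.Divisibility
open import Data.Nat.DivMod using (m*[n/m]≡n)
open import Data.Nat.Induction using (<-rec)
open import Data.Nat.ListAction using (product)
open import Data.Nat.ListAction.Properties using (∈⇒∣product; product≢0)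
open import Data.Nat.Primality
open import Data.Nat.Primality.Factorisation using (factorise; factorisationHasAllPrimeFactors)
open import Data.Nat.Properties
open import Data.Nat.Tactic.RingSolver using (solve-∀)
open import Data.Product using (Σ-syntax; ∃₂; _×_; _,_; proj₁; proj₂)
open import Data.Sum using (inj₁; inj₂; [_,_]′)
open import Data.Unit using (tt)
open import Defs
open import Function using (_∘_; id)
open import Function.Bundles using (Equivalence)
open import Relation.Binary.PropositionalEquality
open import Relation.Nullary using (yes; no; contradiction; ¬?)
open import Relation.Nullary.Decidable using (toWitness)
open import Relation.Unary using (Decidable)

open ≤-Reasoning

-- Coprimality, prime powers and integer logarithms.

coprime-*∣ : ∀ {a b x} → Coprime a b → a ∣ x → b ∣ x → a * b ∣ x
coprime-*∣ {a} {b} c a∣x (divides q refl) =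
  *-monoˡ-∣ b (coprime-divisor c (subst (a ∣_) (*-comm q b) a∣x))

prime∤⇒coprime : ∀ {p n} → Prime p → p ∤ n → Coprime p n
prime∤⇒coprime pp p∤n (d∣p , d∣n) =
  [ (λ d≡1 → d≡1) , (λ { refl → contradiction d∣n p∤n }) ]′ (prime⇒irreducible pp d∣p)

coprime-^ : ∀ {p n} → Coprime p n → ∀ e → Coprime (p ^ e) n
coprime-^ c zero    (d∣1 , _)   = ∣1⇒≡1 d∣1
-- A common divisor of `p * p ^ e` and `n` is coprime to `p`, because it divides `n`. Hence it
-- divides `p ^ e`.
coprime-^ c (suc e) (d∣pp , d∣n) = coprime-^ c e
  (coprime-divisor (λ { (i∣d , i∣p) → c (i∣p , ∣-trans i∣d d∣n) }) d∣pp , d∣n)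

prime>1 : ∀ {p} → Prime p → 1 < p
prime>1 {p} pp = nonTrivial⇒n>1 p {{prime⇒nonTrivial pp}}

product-uniquePrimes-∣ : ∀ {x} ps → Unique ps → All Prime ps → All (_∣ x) ps → product ps ∣ x
product-uniquePrimes-∣ []       _ _ _ = 1∣ _
product-uniquePrimes-∣ (p ∷ ps) u@(_ ∷ ups) (pp ∷ pps) (p∣x ∷ ps∣x) =
  coprime-*∣ (prime∤⇒coprime pp p∤ps) p∣x (product-uniquePrimes-∣ ps ups pps ps∣x)
  where
  p∤ps : p ∤ product ps
  p∤ps p∣ps = Unique.Unique[x∷xs]⇒x∉xs u (factorisationHasAllPrimeFactors pp p∣ps pps)

extractPower : ∀ {p} → Prime p → ∀ n → .{{NonZero n}} → ∃₂ λ e m → n ≡ p ^ e * m × p ∤ m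
extractPower {p} pp = λ n →
  <-rec (λ n → .{{NonZero n}} → ∃₂ λ e m → n ≡ p ^ e * m × p ∤ m) step n
  where
  instance
    _ = prime⇒nonZero pp
  step : ∀ n → (∀ {m} → m < n → .{{NonZero m}} → ∃₂ λ e k → m ≡ p ^ e * k × p ∤ k) →
         .{{NonZero n}} → ∃₂ λ e m → n ≡ p ^ e * m × p ∤ m
  step n rec with p ∣? n
  ... | no  p∤n = 0 , n , sym (*-identityˡ n) , p∤n
  ... | yes (divides q refl) with rec (m<m*n q p {{m*n≢0⇒m≢0 q}} (prime>1 pp)) {{m*n≢0⇒m≢0 q}}
  ...   | e , m , refl , p∤m = suc e , m , trans (*-comm _ p) (sym (*-assoc p (p ^ e) m)) , p∤m

-- Floor of the base-b logarithm; log b 0 = 0.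
log : ℕ → ℕ → ℕ
log b zero    = 0
log b (suc n) with b ^ suc (log b n) ≤? suc n
... | yes _ = suc (log b n)
... | no  _ = log b n

b^log≤ : ∀ b n → .{{NonZero n}} → b ^ log b n ≤ n
b^log≤ b (suc n) with b ^ suc (log b n) ≤? suc n
b^log≤ b (suc n)       | yes le = le
b^log≤ b (suc zero)    | no _ = ≤-refl
b^log≤ b (suc (suc n)) | no _ = m≤n⇒m≤1+n (b^log≤ b (suc n))

n<b^[1+log] : ∀ b n → 1 < b → n < b ^ suc (log b n)
n<b^[1+log] b zero    1<b = subst (0 <_) (sym (*-identityʳ b)) (<-trans z<s 1<b)
n<b^[1+log] b (suc n) 1<b with b ^ suc (log b n) ≤? suc n
... | yes _ = ≤-<-trans (n<b^[1+log] b n 1<b) (^-monoʳ-< b 1<b (n<1+n (suc (log b n))))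
... | no gt = ≰⇒> gt

^-cancelʳ-≤ : ∀ b {m n} → 1 < b → b ^ m ≤ b ^ n → m ≤ n
^-cancelʳ-≤ b 1<b le = ≮⇒≥ λ n<m → <⇒≱ (^-monoʳ-< b 1<b n<m) le

^-monoʳ-∣ : ∀ b {m n} → m ≤ n → b ^ m ∣ b ^ n
^-monoʳ-∣ b {m} {n} m≤n = subst (λ k → b ^ m ∣ b ^ k) (m+[n∸m]≡n m≤n)
  (subst (b ^ m ∣_) (sym (^-distribˡ-+-* b m (n ∸ m))) (m∣m*n _))

-- The least common multiple of 1, ..., n.

largestPower : ℕ → ℕ → ℕ
largestPower n p = p ^ log p n

primesUpTo : ℕ → List ℕ
primesUpTo n = filter prime? (upTo (suc n))

-- The lcm in factored form, one prime power per prime, so that its size can be estimated prime by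
-- prime.
lcmUpTo : ℕ → ℕ
lcmUpTo n = product (map (largestPower n) (primesUpTo n))

-- Strong induction on `j`: a prime factor `p` of `j` gives `j = p ^ suc e * m` with `p ∤ m`. The
-- power is at most `n`, so it divides the factor belonging to `p`. The smaller cofactor `m` divides
-- by induction, and the two are coprime.
∣lcmUpTo : ∀ n j → .{{NonZero j}} → j ≤ n → j ∣ lcmUpTo n
∣lcmUpTo n = λ j → <-rec (λ j → .{{NonZero j}} → j ≤ n → j ∣ lcmUpTo n) step j
  where
  step : ∀ j → (∀ {i} → i < j → .{{NonZero i}} → i ≤ n → i ∣ lcmUpTo n) →
         .{{NonZero j}} → j ≤ n → j ∣ lcmUpTo n
  step j rec j≤n with factorise j
  ... | record { factors = [] ; isFactorisation = refl } = 1∣ _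
  ... | record { factors = p ∷ ps ; isFactorisation = j≡ ; factorsPrime = pp ∷ _ }
    with extractPower pp j
  ...   | zero  , m , refl , p∤m = contradiction
          (subst (p ∣_) (trans (sym j≡) (*-identityˡ m)) (m∣m*n (product ps))) p∤m
  ...   | suc e , m , refl , p∤m = coprime-*∣
          (coprime-^ (prime∤⇒coprime pp p∤m) (suc e))
          (∣-trans (^-monoʳ-∣ p e<log) (∈⇒∣product (∈-map⁺ (largestPower n) p∈)))
          (rec m<j (≤-trans (<⇒≤ m<j) j≤n))
    where
    instance
      _ = prime⇒nonZero pp
      m≢0 : NonZero m
      m≢0 = m*n≢0⇒n≢0 (p ^ suc e)
      pe≢0 : NonZero (p ^ suc e)
      pe≢0 = m^n≢0 p (suc e)
      p^e≢0 : NonZero (p ^ e)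
      p^e≢0 = m^n≢0 p e
      n≢0 : NonZero n
      n≢0 = >-nonZero (<-≤-trans (>-nonZero⁻¹ (p ^ suc e * m)) j≤n)
    1<p^ : 1 < p ^ suc e
    1<p^ = <-≤-trans (prime>1 pp) (m≤m*n p (p ^ e))
    p^≤n : p ^ suc e ≤ n
    p^≤n = ≤-trans (m≤m*n (p ^ suc e) m) j≤n
    m<j : m < p ^ suc e * m
    m<j = subst (m <_) (*-comm m (p ^ suc e)) (m<m*n m (p ^ suc e) 1<p^)
    e<log : suc e ≤ log p n
    e<log = ≮⇒≥ λ log<e → <⇒≱ (n<b^[1+log] p n (prime>1 pp))
      (≤-trans (^-monoʳ-≤ p log<e) p^≤n)
    p∈ : p ∈ primesUpTo n
    p∈ = ∈-filter⁺ prime? (∈-upTo⁺ (s≤s (≤-trans (m≤m*n p (p ^ e)) p^≤n))) pp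

-- Binomial coefficients, the Leibniz triangle and the lower bound for the lcm.

C-absorb : ∀ n k → suc n * (n C k) ≡ suc k * (suc n C suc k)
C-absorb zero    zero    = refl
C-absorb zero    (suc k) = sym (trans
  (cong (suc (suc k) *_) (k>n⇒nCk≡0 {1} {2 + k} (s<s z<s))) (*-zeroʳ (suc (suc k))))
C-absorb (suc n) zero    = trans (*-identityʳ (suc (suc n))) (sym (trans (+-identityʳ _) (nC1≡n (2 + n))))
C-absorb (suc n) (suc k) = begin-equality
  c + suc n * c                            ≡⟨ cong (λ z → c + suc n * z) (nCk+nC[k+1]≡[n+1]C[k+1] n k) ⟨
  c + suc n * (n C k + n C suc k)          ≡⟨ cong (c +_) (*-distribˡ-+ (suc n) (n C k) (n C suc k)) ⟩
  c + (suc n * (n C k) + suc n * (n C suc k))  ≡⟨ cong (c +_) (cong₂ _+_ (C-absorb n k) (C-absorb n (suc k))) ⟩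
  c + (suc k * c + (2 + k) * d)            ≡⟨ +-assoc c _ _ ⟨
  (2 + k) * c + (2 + k) * d                ≡⟨ *-distribˡ-+ (2 + k) c d ⟨
  (2 + k) * (c + d)                        ≡⟨ cong ((2 + k) *_) (nCk+nC[k+1]≡[n+1]C[k+1] (suc n) (suc k)) ⟩
  (2 + k) * (suc (suc n) C suc (suc k))    ∎
  where
  c = suc n C suc k
  d = suc n C suc (suc k)

C≢0 : ∀ {n k} → k ≤ n → NonZero (n C k)
C≢0 {n}     {zero}  _         = _
C≢0 {suc n} {suc k} (s≤s k≤n) = subst NonZero (nCk+nC[k+1]≡[n+1]C[k+1] n k)
  (>-nonZero (<-≤-trans (>-nonZero⁻¹ (n C k) {{C≢0 k≤n}}) (m≤m+n _ _)))

C≤2^ : ∀ n k → n C k ≤ 2 ^ n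
C≤2^ n       zero    = m^n>0 2 n
C≤2^ zero    (suc k) = ≤-trans (≤-reflexive (k>n⇒nCk≡0 {0} {suc k} z<s)) z≤n
C≤2^ (suc n) (suc k) = begin
  suc n C suc k       ≡⟨ nCk+nC[k+1]≡[n+1]C[k+1] n k ⟨
  n C k + n C suc k   ≤⟨ +-mono-≤ (C≤2^ n k) (C≤2^ n (suc k)) ⟩
  2 ^ n + 2 ^ n       ≡⟨ cong (2 ^ n +_) (+-identityʳ (2 ^ n)) ⟨
  2 ^ suc n           ∎

rowSum : ℕ → ℕ → ℕ
rowSum n zero    = 0
rowSum n (suc k) = n C k + rowSum n k

rowSum-pascal : ∀ n k → rowSum (suc n) (suc k) ≡ rowSum n (suc k) + rowSum n k
rowSum-pascal n zero    = refl
rowSum-pascal n (suc k) = begin-equality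
  suc n C suc k + rowSum (suc n) (suc k)
    ≡⟨ cong₂ _+_ (nCk+nC[k+1]≡[n+1]C[k+1] n k) (sym (rowSum-pascal n k)) ⟨
  (n C k + n C suc k) + (rowSum n (suc k) + rowSum n k)
    ≡⟨ shuffle (n C k) (n C suc k) (rowSum n (suc k)) (rowSum n k) ⟩
  (n C suc k + rowSum n (suc k)) + (n C k + rowSum n k) ∎
  where
  shuffle : ∀ a b c d → (a + b) + (c + d) ≡ (b + c) + (a + d)
  shuffle = solve-∀

2^n≤rowSum : ∀ n → 2 ^ n ≤ rowSum n (suc n)
2^n≤rowSum zero    = ≤-refl
2^n≤rowSum (suc n) = begin
  2 ^ n + (2 ^ n + 0)                        ≡⟨ cong (2 ^ n +_) (+-identityʳ (2 ^ n)) ⟩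
  2 ^ n + 2 ^ n                              ≤⟨ +-mono-≤ (2^n≤rowSum n) (2^n≤rowSum n) ⟩
  -- Extends the first sum by the entry `n C suc n`, giving the shape of `rowSum-pascal`.
  rowSum n (suc n) + rowSum n (suc n)        ≤⟨ +-monoˡ-≤ _ (m≤n+m _ (n C suc n)) ⟩
  rowSum n (2 + n) + rowSum n (suc n)        ≡⟨ rowSum-pascal n (suc n) ⟨
  rowSum (suc n) (2 + n)                     ∎

-- The hypothesis is 1/a = 1/b + 1/d with denominators cleared, whence x/d = x/a − x/b.
reciprocals-∣ : ∀ {a b d x} .{{_ : NonZero a}} → b * d ≡ a * (b + d) → a ∣ x → b ∣ x → d ∣ x
reciprocals-∣ {a} {b} {d} {x} bd (divides q x≡qa) (divides s x≡sb) =
  ∣m+n∣m⇒∣n (subst (d ∣_) (*-cancelˡ-≡ (d * q) (s * d + x) a key) (m∣m*n q)) (n∣m*n s)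
  where
  key : a * (d * q) ≡ a * (s * d + x)
  key = begin-equality
    a * (d * q)               ≡⟨ e₁ a d q ⟩
    (q * a) * d               ≡⟨ cong (_* d) (trans (sym x≡qa) x≡sb) ⟩
    (s * b) * d               ≡⟨ *-assoc s b d ⟩
    s * (b * d)               ≡⟨ cong (s *_) bd ⟩
    s * (a * (b + d))         ≡⟨ e₂ s a b d ⟩
    a * (s * d + s * b)       ≡⟨ cong (λ z → a * (s * d + z)) x≡sb ⟨
    a * (s * d + x)           ∎
    where
    e₁ : ∀ a d q → a * (d * q) ≡ (q * a) * d
    e₁ = solve-∀
    e₂ : ∀ s a b d → s * (a * (b + d)) ≡ a * (s * d + s * b)
    e₂ = solve-∀

-- Induction on the column `k`. Column 0 holds the numbers 1, ..., N. An entry of column `suc k`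
-- comes from two entries of column `k`, in its own row and the row before, by the Leibniz rule for
-- reciprocals, cleared of denominators in `identity`.
leibniz-∣ : ∀ {N x} → (∀ j → .{{NonZero j}} → j ≤ N → j ∣ x) →
            ∀ n k → n < N → k ≤ n → suc n * (n C k) ∣ x
leibniz-∣ {x = x} div n zero    n<N _ = subst (_∣ x) (sym (*-identityʳ (suc n))) (div (suc n) n<N)
leibniz-∣ div (suc n) (suc k) n<N (s≤s k≤n) = reciprocals-∣
  {{m*n≢0 (suc n) (n C k) {{_}} {{C≢0 k≤n}}}} identity
  (leibniz-∣ div n k (<-trans (n<1+n n) n<N) k≤n)
  (leibniz-∣ div (suc n) k n<N (m≤n⇒m≤1+n k≤n))
  where
  u = suc n C k
  v = suc n C suc k
  identity : (2 + n) * u * ((2 + n) * v) ≡ suc n * (n C k) * ((2 + n) * u + (2 + n) * v)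
  identity = begin-equality
    (2 + n) * u * ((2 + n) * v)                   ≡⟨ cong (_* ((2 + n) * v)) (C-absorb (suc n) k) ⟩
    suc k * ((2 + n) C suc k) * ((2 + n) * v)       ≡⟨ e (suc k) ((2 + n) C suc k) (2 + n) v ⟩
    suc k * v * ((2 + n) * ((2 + n) C suc k))       ≡⟨ cong₂ (λ y z → y * ((2 + n) * z)) (C-absorb n k) (nCk+nC[k+1]≡[n+1]C[k+1] (suc n) k) ⟨
    suc n * (n C k) * ((2 + n) * (u + v))         ≡⟨ cong (suc n * (n C k) *_) (*-distribˡ-+ (2 + n) u v) ⟩
    suc n * (n C k) * ((2 + n) * u + (2 + n) * v) ∎
    where
    e : ∀ a b c d → a * b * (c * d) ≡ a * d * (c * b)
    e = solve-∀

-- Each of the `suc n` numbers `suc n * (n C k)` divides the nonzero `x` and so is at most `x`.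
-- Adding them and cancelling `suc n` gives the bound.
2^n≤commonMultiple : ∀ {n x} .{{_ : NonZero x}} →
  (∀ j → .{{NonZero j}} → j ≤ suc n → j ∣ x) → 2 ^ n ≤ x
2^n≤commonMultiple {n} {x} div = *-cancelˡ-≤ (suc n) (begin
  suc n * 2 ^ n            ≤⟨ *-monoʳ-≤ (suc n) (2^n≤rowSum n) ⟩
  suc n * rowSum n (suc n) ≤⟨ sum≤ (suc n) ≤-refl ⟩
  suc n * x                ∎)
  where
  sum≤ : ∀ k → k ≤ suc n → suc n * rowSum n k ≤ k * x
  sum≤ zero    _   = ≤-reflexive (*-zeroʳ (suc n))
  sum≤ (suc k) k<n = begin
    suc n * (n C k + rowSum n k)             ≡⟨ *-distribˡ-+ (suc n) (n C k) (rowSum n k) ⟩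
    suc n * (n C k) + suc n * rowSum n k     ≤⟨ +-mono-≤ (∣⇒≤ (leibniz-∣ div n k ≤-refl (s≤s⁻¹ k<n))) (sum≤ k (<⇒≤ k<n)) ⟩
    x + k * x                                ∎

-- Splitting products and counting distinct entries of lists.

product-map-filter : ∀ {P : ℕ → Set} (P? : Decidable P) (f : ℕ → ℕ) xs →
  product (map f xs) ≡ product (map f (filter P? xs)) * product (map f (filter (¬? ∘ P?) xs))
product-map-filter P? f []       = refl
product-map-filter P? f (x ∷ xs) with P? x
... | yes _ = trans (cong (f x *_) (product-map-filter P? f xs)) (sym (*-assoc (f x) _ _))
... | no  _ = trans (cong (f x *_) (product-map-filter P? f xs)) (swap (f x) (product (map f (filter P? xs))) _)
  where
  swap : ∀ a b c → a * (b * c) ≡ b * (a * c)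
  swap = solve-∀

product-filter : ∀ {P : ℕ → Set} (P? : Decidable P) xs →
  product xs ≡ product (filter P? xs) * product (filter (¬? ∘ P?) xs)
product-filter P? xs = subst₂ _≡_ (cong product (map-id xs))
  (cong₂ (λ ys zs → product ys * product zs) (map-id (filter P? xs)) (map-id (filter (¬? ∘ P?) xs))) (product-map-filter P? id xs)

product-≤^ : ∀ {b xs} → All (_≤ b) xs → product xs ≤ b ^ length xs
product-≤^ []         = ≤-refl
product-≤^ (px ∷ pxs) = *-mono-≤ px (product-≤^ pxs)

product-map-≤ : ∀ f {xs} → All (λ x → f x ≤ x) xs → product (map f xs) ≤ product xs
product-map-≤ f []         = ≤-refl
product-map-≤ f (px ∷ pxs) = *-mono-≤ px (product-map-≤ f pxs)

lookup-injective : ∀ {xs : List ℕ} → Unique xs → ∀ {i j} → lookup xs i ≡ lookup xs j → i ≡ j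
lookup-injective (_ ∷ _)  {zero}  {zero}  _  = refl
lookup-injective (x∉ ∷ _) {zero}  {suc j} eq = contradiction eq (All.lookup x∉ (∈-lookup j))
lookup-injective (x∉ ∷ _) {suc i} {zero}  eq = contradiction (sym eq) (All.lookup x∉ (∈-lookup i))
lookup-injective (_ ∷ u)  {suc i} {suc j} eq = cong suc (lookup-injective u eq)

-- Pigeonhole: without repetitions, sending a position to its entry is an injection into `Fin r`.
unique-length≤ : ∀ {r xs} → Unique xs → All (_< r) xs → length xs ≤ r
unique-length≤ {r} {xs} u xs<r = injective⇒≤ {f = λ i → fromℕ< (All.lookup xs<r (∈-lookup i))}
  (lookup-injective u ∘ fromℕ<-injective _ _ _ _)

-- An upper bound for products of distinct primes.

prime∤! : ∀ {p} → Prime p → ∀ n → n < p → p ∤ n !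
prime∤! pp zero    _   p∣1 = contradiction (∣1⇒≡1 p∣1) (>⇒≢ (prime>1 pp))
prime∤! pp (suc n) n<p p∣n! with euclidsLemma (suc n) (n !) pp p∣n!
... | inj₁ p∣1+n = contradiction (∣⇒≤ p∣1+n) (<⇒≱ n<p)
... | inj₂ p∣n!′ = prime∤! pp n (<-trans (n<1+n n) n<p) p∣n!′

-- `p` divides `n !`, but neither `k !` nor `(n ∸ k) !`, both being factorials of numbers below `p`.
prime∣C : ∀ {p n k} → Prime p → k ≤ n → k < p → n ∸ k < p → p ≤ n → p ∣ n C k
prime∣C {p} {n} {k} pp k≤n k<p n∸k<p p≤n with euclidsLemma (k ! * (n ∸ k) !) (n C k) pp
  (subst (p ∣_) (sym n!≡) (∣-trans (m∣m! p) (m≤n⇒m!∣n! p≤n)))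
  where
  instance
    _ = k !* (n ∸ k) !≢0
  n!≡ : k ! * (n ∸ k) ! * (n C k) ≡ n !
  n!≡ = trans (cong (k ! * (n ∸ k) ! *_) (nCk≡n!/k![n-k]! k≤n)) (m*[n/m]≡n (k![n∸k]!∣n! k≤n))
  m∣m! : ∀ m → .{{NonZero m}} → m ∣ m !
  m∣m! (suc m) = m∣m*n (m !)
  instance
    _ = prime⇒nonZero pp
... | inj₂ p∣C = p∣C
... | inj₁ p∣d with euclidsLemma (k !) ((n ∸ k) !) pp p∣d
...   | inj₁ p∣k! = contradiction p∣k! (prime∤! pp k k<p)
...   | inj₂ p∣!  = contradiction p∣! (prime∤! pp (n ∸ k) n∸k<p)

-- Induction by halving. The primes above `⌈ n /2⌉` all divide the central coefficient
-- `n C ⌊ n /2⌋`, which is at most `2 ^ n`; the others are covered by the induction hypothesis.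
-- Arbitrary lists of distinct primes are allowed, so that it applies to filtered lists.
primorial≤ : ∀ n ps → Unique ps → All Prime ps → All (_≤ n) ps → product ps ≤ 2 ^ (3 * n)
primorial≤ = <-rec
  (λ n → ∀ ps → Unique ps → All Prime ps → All (_≤ n) ps → product ps ≤ 2 ^ (3 * n)) step
  where
  small : ∀ n ps → n ≤ 1 → All Prime ps → All (_≤ n) ps → product ps ≤ 2 ^ (3 * n)
  small n []      _   _        _         = m^n>0 2 (3 * n)
  small n (_ ∷ _) n≤1 (pp ∷ _) (p≤n ∷ _) = contradiction (prime>1 pp) (≤⇒≯ (≤-trans p≤n n≤1))
  step : ∀ n → (∀ {m} → m < n → ∀ ps → Unique ps → All Prime ps → All (_≤ m) ps → product ps ≤ 2 ^ (3 * m)) →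
         ∀ ps → Unique ps → All Prime ps → All (_≤ n) ps → product ps ≤ 2 ^ (3 * n)
  step 0 _ ps _ = small 0 ps z≤n
  step 1 _ ps _ = small 1 ps ≤-refl
  step n@(suc (suc n-2)) rec ps u pps ps≤n = begin
    product ps                     ≡⟨ product-filter (_≤? a) ps ⟩
    product lo * product hi        ≤⟨ *-mono-≤ lo≤ hi≤ ⟩
    2 ^ (3 * a) * 2 ^ n            ≡⟨ ^-distribˡ-+-* 2 (3 * a) n ⟨
    2 ^ (3 * a + n)                ≤⟨ ^-monoʳ-≤ 2 3a+n≤3n ⟩
    2 ^ (3 * n)                    ∎
    where
    a = ⌈ n /2⌉
    b = ⌊ n /2⌋
    lo = filter (_≤? a) ps
    hi = filter (¬? ∘ (_≤? a)) ps
    b≤a : b ≤ a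
    b≤a = ⌊n/2⌋≤⌈n/2⌉ n
    b≤n : b ≤ n
    b≤n = ⌊n/2⌋≤n n
    n∸b≡a : n ∸ b ≡ a
    n∸b≡a = trans (cong (_∸ b) (sym (⌊n/2⌋+⌈n/2⌉≡n n))) (m+n∸m≡n b a)
    lo≤ : product lo ≤ 2 ^ (3 * a)
    lo≤ = rec (⌈n/2⌉<n n-2) lo (Unique.filter⁺ (_≤? a) u) (All.filter⁺ (_≤? a) pps) (All.all-filter (_≤? a) ps)
    hi∣ : All (_∣ n C b) hi
    -- A prime above `a` exceeds both `b` and `n ∸ b`, which is `a`.
    hi∣ = All.map (λ { (p≰a , pp , p≤n) → prime∣C pp b≤n (≤-<-trans b≤a (≰⇒> p≰a))
                                            (≤-<-trans (≤-reflexive n∸b≡a) (≰⇒> p≰a)) p≤n })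
      (All.zip (All.all-filter (¬? ∘ (_≤? a)) ps ,
                All.filter⁺ (¬? ∘ (_≤? a)) (All.zip (pps , ps≤n))))
    hi≤ : product hi ≤ 2 ^ n
    hi≤ = ≤-trans
      (∣⇒≤ {{C≢0 b≤n}} (product-uniquePrimes-∣ hi (Unique.filter⁺ _ u) (All.filter⁺ _ pps) hi∣))
      (C≤2^ n b)
    a≤2b : a ≤ b + b
    -- From `n ≥ 2` follow `a ≤ b + 1` and `b ≥ 1`. Equality `a = 2b` occurs at `n = 3`. The factor
    -- 3 in the exponent works because `3a ≤ 2a + 2b = 2n`.
    a≤2b = ≤-trans (⌊n/2⌋-mono (n≤1+n (3 + n-2)))
             (≤-trans (≤-reflexive (+-comm 1 b)) (+-monoʳ-≤ b (s≤s z≤n)))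
    3a+n≤3n : 3 * a + n ≤ 3 * n
    3a+n≤3n = begin
      3 * a + n                          ≡⟨ e₁ a n ⟩
      (a + (a + a)) + n                  ≤⟨ +-monoˡ-≤ n (+-monoˡ-≤ (a + a) a≤2b) ⟩
      ((b + b) + (a + a)) + n            ≡⟨ e₂ a b n ⟩
      ((b + a) + (b + a)) + n            ≡⟨ cong (λ z → z + z + n) (⌊n/2⌋+⌈n/2⌉≡n n) ⟩
      (n + n) + n                        ≡⟨ e₃ n ⟩
      3 * n                              ∎
      where
      e₁ : ∀ a n → 3 * a + n ≡ (a + (a + a)) + n
      e₁ = solve-∀
      e₂ : ∀ a b n → ((b + b) + (a + a)) + n ≡ ((b + a) + (b + a)) + n
      e₂ = solve-∀
      e₃ : ∀ n → (n + n) + n ≡ 3 * n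
      e₃ = solve-∀

-- The upper bound for the lcm.

-- The exponent is 0 or 1, since `p * p ≥ r * r > n`.
largestPower≤ : ∀ {n p r} → Prime p → n < r * r → r ≤ p → largestPower n p ≤ p
largestPower≤ {n} {p} {r} pp n<r² r≤p with log p n in eq
... | 0 = <⇒≤ (prime>1 pp)
... | 1 = ≤-reflexive (*-identityʳ p)
... | suc (suc e) = contradiction p²≤n (<⇒≱ (<-≤-trans n<r² (*-mono-≤ r≤p r≤p)))
  where
  instance
    _ = prime⇒nonZero pp
  n≢0 : NonZero n
  -- `log p 0` is 0 by convention, whereas the exponent here is at least 2.
  n≢0 = ≢-nonZero λ { refl → contradiction eq λ () }
  p²≤n : p * p ≤ n
  p²≤n = begin
    p * p            ≤⟨ *-monoʳ-≤ p (m≤m*n p (p ^ e) {{m^n≢0 p e}}) ⟩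
    p * (p * p ^ e)  ≡⟨ cong (p ^_) eq ⟨
    p ^ log p n      ≤⟨ b^log≤ p n {{n≢0}} ⟩
    n                ∎

-- The primes p ≤ N with p > n and p ≥ r.
largePrimes : ℕ → ℕ → ℕ → List ℕ
largePrimes r n N = filter (¬? ∘ (_≤? n)) (filter (¬? ∘ (_<? r)) (primesUpTo N))

largePrimes-unique : ∀ r n N → Unique (largePrimes r n N)
largePrimes-unique r n N =
  Unique.filter⁺ _ (Unique.filter⁺ _ (Unique.filter⁺ prime? (Unique.upTo⁺ (suc N))))

largePrimes-all : ∀ r n N → All (λ p → Prime p × n < p × p ≤ N) (largePrimes r n N)
largePrimes-all r n N = All.zipWith (λ { (p≰n , pp , p<1+N) → pp , ≰⇒> p≰n , s≤s⁻¹ p<1+N })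
  (All.all-filter >n? (filter ≥r? (primesUpTo N)) ,
   All.filter⁺ >n? (All.filter⁺ ≥r? (All.zip (All.all-filter prime? (upTo (suc N)) ,
                                              All.filter⁺ prime? (All.all-upTo (suc N))))))
  where
  >n? = ¬? ∘ (_≤? n)
  ≥r? = ¬? ∘ (_<? r)

lcmUpTo≤ : ∀ r n N → .{{NonZero N}} → N < r * r →
  lcmUpTo N ≤ N ^ r * (2 ^ (3 * n) * N ^ length (largePrimes r n N))
lcmUpTo≤ r n N N<r² = begin
  lcmUpTo N
    ≡⟨ product-map-filter (_<? r) pw ps ⟩
  product (map pw tiny) * product (map pw rest)
    ≤⟨ *-mono-≤ tiny≤ (product-map-≤ pw (All.map (λ { (p≮r , pp) → largestPower≤ pp N<r² (≮⇒≥ p≮r) })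
         (All.zip (All.all-filter (¬? ∘ (_<? r)) ps , All.filter⁺ _ primes)))) ⟩
  N ^ r * product rest
    ≡⟨ cong (N ^ r *_) (product-filter (_≤? n) rest) ⟩
  N ^ r * (product (filter (_≤? n) rest) * product (largePrimes r n N))
    ≤⟨ *-monoʳ-≤ (N ^ r) (*-mono-≤
         (primorial≤ n _ (Unique.filter⁺ _ (Unique.filter⁺ _ unique))
           (All.filter⁺ _ (All.filter⁺ _ primes)) (All.all-filter _ rest))
         (product-≤^ (All.filter⁺ _ (All.filter⁺ _ ≤N)))) ⟩
  N ^ r * (2 ^ (3 * n) * N ^ length (largePrimes r n N)) ∎
  where
  pw = largestPower N
  ps = primesUpTo N
  tiny = filter (_<? r) ps
  rest = filter (¬? ∘ (_<? r)) ps
  unique : Unique ps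
  unique = Unique.filter⁺ prime? (Unique.upTo⁺ (suc N))
  primes : All Prime ps
  primes = All.all-filter prime? (upTo (suc N))
  ≤N : All (_≤ N) ps
  ≤N = All.filter⁺ prime? (All.map s≤s⁻¹ (All.all-upTo (suc N)))
  tiny≤ : product (map pw tiny) ≤ N ^ r
  tiny≤ = begin
    product (map pw tiny)      ≤⟨ product-≤^ (All.map⁺ (All.universal (λ p → b^log≤ p N) tiny)) ⟩
    N ^ length (map pw tiny)   ≡⟨ cong (N ^_) (length-map pw tiny) ⟩
    -- The number of primes below `r` is bounded crudely by `r`.
    N ^ length tiny            ≤⟨ ^-monoʳ-≤ N (unique-length≤ (Unique.filter⁺ _ unique) (All.all-filter (_<? r) ps)) ⟩
    N ^ r                      ∎

-- Comparing the two bounds for n ≥ 293.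

4^k≡[2^k]² : ∀ k → 4 ^ k ≡ 2 ^ k * 2 ^ k
4^k≡[2^k]² k = trans (^-*-assoc 2 2 k) (trans (cong (λ z → 2 ^ (k + z)) (+-identityʳ k)) (^-distribˡ-+-* 2 k k))

lcmUpTo≢0 : ∀ n → NonZero (lcmUpTo n)
lcmUpTo≢0 n = product≢0 (All.map⁺ (All.map (λ {p} pp → m^n≢0 p (log p n) {{prime⇒nonZero pp}})
  (All.all-filter prime? (upTo (suc n)))))

-- If N < 4 ^ (k + 1), r = 2 ^ (k + 1) and c ≤ 3247, then N ^ r * N ^ c ≤ 2 ^ exponentBound k;
-- 135324 below is 2 * exponentBound 8, and 2 * exponentBound k ≤ 4 ^ k from k = 9 on.
exponentBound : ℕ → ℕ
exponentBound k = 2 * suc k * (2 ^ suc k + 3247)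

exponentBound≤ : ∀ k → 2 * exponentBound k ≤ 4 ^ k + 135324
exponentBound≤ k with k ≤? 8
... | yes k≤8 = toWitness {a? = allUpTo? (λ k → 2 * exponentBound k ≤? 4 ^ k + 135324) 9} tt (s≤s k≤8)
... | no  k≰8 = subst (λ k → 2 * exponentBound k ≤ 4 ^ k + 135324) (m+[n∸m]≡n (≰⇒> k≰8))
                  (≤-trans (from9 (k ∸ 9)) (m≤m+n _ _))
  where
  -- Passing from `k` to `suc k` at most doubles each of the factors `suc k` and `2 ^ suc k + 3247`,
  -- hence at most quadruples the bound, while `4 ^ k` exactly quadruples.
  step : ∀ k → 2 * exponentBound (suc k) ≤ 4 * (2 * exponentBound k)
  step k = begin
    2 * (2 * (2 + k) * (2 ^ (2 + k) + 3247))
      ≤⟨ *-monoʳ-≤ 2 (*-mono-≤ (*-monoʳ-≤ 2 (s≤s (m≤n+m (suc k) k))) (+-monoʳ-≤ (2 ^ (2 + k)) (m≤m+n 3247 3247))) ⟩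
    2 * (2 * (suc k + suc k) * (2 * 2 ^ suc k + 6494))
      ≡⟨ e (suc k) (2 ^ suc k) ⟩
    4 * (2 * (2 * suc k * (2 ^ suc k + 3247))) ∎
    where
    e : ∀ a b → 2 * (2 * (a + a) * (2 * b + 6494)) ≡ 4 * (2 * (2 * a * (b + 3247)))
    e = solve-∀
  from9 : ∀ j → 2 * exponentBound (9 + j) ≤ 4 ^ (9 + j)
  from9 zero    = ≤ᵇ⇒≤ (2 * exponentBound 9) (4 ^ 9) tt
  from9 (suc j) = subst (λ k → 2 * exponentBound k ≤ 4 ^ k) (sym (+-suc 9 j)) (≤-trans (step (9 + j)) (*-monoʳ-≤ 4 (from9 j)))

linearBound : ∀ {M n K} → 2 + M ≡ 520 * n → 2 * M ≤ (suc M + K) + 6 * n → 514 * n ≤ 3 + K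
linearBound {M} {n} {K} 2+M≡ 2M≤ = +-cancelʳ-≤ (6 * n) (514 * n) (3 + K) (begin
  514 * n + 6 * n       ≡⟨ *-distribʳ-+ n 514 6 ⟨
  520 * n               ≡⟨ 2+M≡ ⟨
  2 + M                 ≤⟨ +-monoʳ-≤ 2 (+-cancelˡ-≤ M M (suc K + 6 * n) (begin
                             M + M                 ≡⟨ cong (M +_) (+-identityʳ M) ⟨
                             2 * M                 ≤⟨ 2M≤ ⟩
                             (suc M + K) + 6 * n   ≡⟨ e M K (6 * n) ⟩
                             M + (suc K + 6 * n)   ∎)) ⟩
  (3 + K) + 6 * n       ∎)
  where
  e : ∀ M K s → (suc M + K) + s ≡ M + (suc K + s)
  e = solve-∀

manyPrimes : ∀ M n → 293 ≤ n → 2 + M ≡ 520 * n →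
             3248 ≤ length (largePrimes (2 ^ suc (log 4 (suc M))) n (suc M))
manyPrimes M n 293≤n 2+M≡ = ≮⇒≥ λ c<3248 →
  -- The resulting inequality `514 * 293 ≤ 3 + 135324`, that is 150602 ≤ 135327, is false, so its
  -- boolean form evaluates to the empty type.
  ≤⇒≤ᵇ (≤-trans (*-monoʳ-≤ 514 293≤n) (linearBound {M} {n} 2+M≡ (2M≤ (s≤s⁻¹ c<3248))))
  where
  N = suc M
  -- Base 4 gives `4 ^ k ≤ N < 4 ^ suc k = r * r`, so `r` exceeds the square root of `N` by a factor
  -- of at most 2.
  k = log 4 N
  r = 2 ^ suc k
  ℓ = 2 * suc k
  c = length (largePrimes r n N)
  N<4^ : N < 4 ^ suc k
  N<4^ = n<b^[1+log] 4 N (s≤s (s≤s z≤n))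
  N^≤ : ∀ e → N ^ e ≤ 2 ^ (ℓ * e)
  N^≤ e = begin
    N ^ e            ≤⟨ ^-monoˡ-≤ e (<⇒≤ N<4^) ⟩
    (4 ^ suc k) ^ e  ≡⟨ cong (_^ e) (^-*-assoc 2 2 (suc k)) ⟩
    (2 ^ ℓ) ^ e      ≡⟨ ^-*-assoc 2 ℓ e ⟩
    2 ^ (ℓ * e)      ∎
  M≤ : M ≤ ℓ * r + (3 * n + ℓ * c)
  M≤ = ^-cancelʳ-≤ 2 (s≤s (s≤s z≤n)) (begin
    2 ^ M                                      ≤⟨ 2^n≤commonMultiple {{lcmUpTo≢0 N}} (∣lcmUpTo N) ⟩
    lcmUpTo N                                  ≤⟨ lcmUpTo≤ r n N (<-≤-trans N<4^ (≤-reflexive (4^k≡[2^k]² (suc k)))) ⟩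
    N ^ r * (2 ^ (3 * n) * N ^ c)              ≤⟨ *-mono-≤ (N^≤ r) (*-monoʳ-≤ (2 ^ (3 * n)) (N^≤ c)) ⟩
    2 ^ (ℓ * r) * (2 ^ (3 * n) * 2 ^ (ℓ * c))  ≡⟨ cong (2 ^ (ℓ * r) *_) (^-distribˡ-+-* 2 (3 * n) (ℓ * c)) ⟨
    2 ^ (ℓ * r) * 2 ^ (3 * n + ℓ * c)          ≡⟨ ^-distribˡ-+-* 2 (ℓ * r) (3 * n + ℓ * c) ⟨
    2 ^ (ℓ * r + (3 * n + ℓ * c))              ∎)
  -- After doubling, the exponents from `r` and `c` total at most `4 ^ k + 135324`, and `4 ^ k ≤ N`
  -- uses up only half of `2 * M`, up to a constant.
  2M≤ : c ≤ 3247 → 2 * M ≤ (N + 135324) + 6 * n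
  2M≤ c≤ = begin
    2 * M                                   ≤⟨ *-monoʳ-≤ 2 (≤-trans M≤ (+-monoʳ-≤ (ℓ * r) (+-monoʳ-≤ (3 * n) (*-monoʳ-≤ ℓ c≤)))) ⟩
    2 * (ℓ * r + (3 * n + ℓ * 3247))        ≡⟨ e ℓ r n 3247 ⟩
    2 * exponentBound k + 6 * n             ≤⟨ +-monoˡ-≤ (6 * n) (≤-trans (exponentBound≤ k) (+-monoˡ-≤ 135324 (b^log≤ 4 N))) ⟩
    (N + 135324) + 6 * n                    ∎
    where
    e : ∀ ℓ r n s → 2 * (ℓ * r + (3 * n + ℓ * s)) ≡ 2 * (ℓ * (r + s)) + 6 * n
    e = solve-∀

-- Trial division for n ≤ 292, and the conclusion.

-- Tests the divisors d + 1, …, d + f of q; `prime?` would be too slow to evaluate.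
noDivisorFrom : ℕ → ℕ → ℕ → Bool
noDivisorFrom zero    d q = true
noDivisorFrom (suc f) d q = if q % suc d ≡ᵇ 0 then false else noDivisorFrom f (suc d) q

-- `k Rough q` excludes divisors of `q` strictly between 1 and `k`; each passed test raises `k` by
-- one.
noDivisor⇒rough : ∀ f d q → T (noDivisorFrom f d q) → suc d Rough q → (suc d + f) Rough q
noDivisor⇒rough zero    d q _ rough = subst (_Rough q) (sym (+-identityʳ (suc d))) rough
noDivisor⇒rough (suc f) d q t rough with q % suc d ≡ᵇ 0 in eq
... | false = subst (_Rough q) (sym (+-suc (suc d) f))
                (noDivisor⇒rough f (suc d) q t (∤⇒rough-suc 1+d∤q rough))
  where
  1+d∤q : suc d ∤ q
  1+d∤q 1+d∣q = subst T eq (≡⇒≡ᵇ (q % suc d) 0 (n∣m⇒m%n≡0 q (suc d) 1+d∣q))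

-- Tests the divisors 2, …, 175, enough for q < 30680 < 176 * 176.
sieve : ℕ → Bool
sieve q = (292 <ᵇ q) ∧ noDivisorFrom 174 1 q

sieve-sound : ∀ {q} → T (sieve q) → q < 30680 → Prime q × 292 < q
sieve-sound {q} t q<30680 =
  rough∧square>⇒prime {{n>1⇒nonTrivial (≤-trans (≤ᵇ⇒≤ 2 292 tt) (<⇒≤ 292<q))}}
    (noDivisor⇒rough 174 1 q (proj₂ parts) 2-rough)
    (≤-trans q<30680 (≤ᵇ⇒≤ 30680 (176 * 176) tt)) , 292<q
  where
  parts = Equivalence.to T-∧ t
  292<q : 292 < q
  292<q = <ᵇ⇒< 292 q (proj₁ parts)

sievedPrimes : List ℕ
sievedPrimes = filter (T? ∘ sieve) (downFrom 30680)

-- Holds by evaluation of the sieve on all numbers below 30680.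
sievedPrimes-count : 3248 ≤ length sievedPrimes
sievedPrimes-count = ≤ᵇ⇒≤ 3248 (length sievedPrimes) tt

theorem3p3p2 : ∀ (n : ℕ) → n > 58 → Σ[ ps ∈ List ℕ ] (Unique ps × All (λ p → Prime p × n < p × p < 520 * n) ps × 3248 ≤ length ps)
theorem3p3p2 n n>58 with n ≤? 292
... | yes n≤292 = sievedPrimes , Unique.filter⁺ (T? ∘ sieve) (Unique.downFrom⁺ 30680) ,
  All.map (λ { (t , q<30680) → let (prime[q] , 292<q) = sieve-sound t q<30680 in
                 prime[q] , ≤-<-trans n≤292 292<q , <-≤-trans q<30680 (*-monoʳ-≤ 520 n>58) })
    (All.zip (All.all-filter (T? ∘ sieve) (downFrom 30680) ,
              All.filter⁺ (T? ∘ sieve) (All.applyDownFrom⁺₁ id 30680 id))) ,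
  sievedPrimes-count
... | no  n≰292 = largePrimes r n N , largePrimes-unique r n N ,
  All.map (λ { (pp , n<p , p≤N) → pp , n<p , <-≤-trans (s≤s p≤N) (≤-reflexive 2+M≡) })
    (largePrimes-all r n N) ,
  manyPrimes (520 * n ∸ 2) n (≰⇒> n≰292) 2+M≡
  where
  -- This is `520 * n - 1`, the largest number allowed, in successor form because the lower bound
  -- for the lcm of 1, ..., N is a power of 2 with exponent `N - 1`. The truncated subtraction is
  -- exact as `520 * n ≥ 2`.
  N = suc (520 * n ∸ 2)
  r = 2 ^ suc (log 4 N)
  2+M≡ : 2 + (520 * n ∸ 2) ≡ 520 * n
  2+M≡ = m+[n∸m]≡n (≤-trans (≤ᵇ⇒≤ 2 (520 * 59) tt) (*-monoʳ-≤ 520 n>58))
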